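{- Let $t$ and $l$ be positive integers with $l\ge 6$. There exists $k_0=k_0(t,l)$ such that for every $k\ge k_0$, whenever the edge set of $\widetilde O_{k+1}$ is partitioned into $t$ parts, the subgraph formed by one of the parts contains a cycle of length $2l$.
   Context: For positive integers $n\ge k+1$, the doubled Johnson graph $J(n;k,k+1)$ is the bipartite graph with vertex set $\binom{[n]}{k}\cup\binom{[n]}{k+1}$ (subsets of $[n]=\{1,\dots,n\}$), where two vertices $u,v$ are adjacent iff $u\subset v$ or $v\subset u$. The doubled Odd graph is $\widetilde O_{k+1}=J(2k+1;k,k+1)$. -}

module Defs where

open import Data.Fin using (Fin; toℕ)
open import Data.Fin.Subset using (Subset; _⊂_; ∣_∣)
open import Data.Fin.Subset.Properties using (⊂-irref)
open import Data.Nat using (ℕ; suc; _+_; _*_; _≤_)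
open import Data.Product using (Σ; ∃-syntax; _×_; proj₁)
open import Data.Sum using (_⊎_; [_,_]′; swap)
open import Function.Definitions using (Injective)
open import Relation.Binary.PropositionalEquality using (_≡_; refl)
open import Relation.Nullary using (¬_)

record Graph : Set₁ where
  field
    Vertex : Set
    Adj    : Vertex → Vertex → Set
    symm   : ∀ {u v} → Adj u v → Adj v u
    irrefl : ∀ {v} → ¬ Adj v v

-- The ground set [n] is Fin n.  The size of a subset determines which summand
-- holds, and proofs of equality in ℕ are unique, so _≡_ on this type is
-- equality of the underlying subsets.
JohnsonVertex : ℕ → ℕ → Set
JohnsonVertex n k = Σ (Subset n) λ p → (∣ p ∣ ≡ k) ⊎ (∣ p ∣ ≡ k + 1)

doubledJohnson : ℕ → ℕ → Graph
doubledJohnson n k = record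
  { Vertex = JohnsonVertex n k
  ; Adj    = λ u v → (proj₁ u ⊂ proj₁ v) ⊎ (proj₁ v ⊂ proj₁ u)
  ; symm   = swap
  ; irrefl = [ ⊂-irref refl , ⊂-irref refl ]′
  }

-- Indexed by k: this is the graph written Õ_{k+1}.
doubledOdd : ℕ → Graph
doubledOdd k = doubledJohnson (2 * k + 1) k

-- A set of (unordered) edges is a symmetric relation contained in Adj.
-- Parts may be empty.
record EdgePartition (G : Graph) (t : ℕ) : Set₁ where
  open Graph G
  field
    Part      : Fin t → Vertex → Vertex → Set
    part-symm : ∀ {i u v} → Part i u v → Part i v u
    part-adj  : ∀ {i u v} → Part i u v → Adj u v
    covers    : ∀ {u v} → Adj u v → ∃[ i ] Part i u v
    disjoint  : ∀ {i j u v} → Part i u v → Part j u v → i ≡ j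

partGraph : ∀ {G t} → EdgePartition G t → Fin t → Graph
partGraph {G} P i = record
  { Vertex = Vertex
  ; Adj    = Part i
  ; symm   = part-symm
  ; irrefl = λ e → irrefl (part-adj e)
  }
  where
  open Graph G
  open EdgePartition P

-- j is the successor of i in the cyclic order on Fin m.
CyclicSucc : ∀ {m} → Fin m → Fin m → Set
CyclicSucc {m} i j = (toℕ j ≡ suc (toℕ i)) ⊎ (suc (toℕ i) ≡ m × toℕ j ≡ 0)

record Cycle (G : Graph) (m : ℕ) : Set where
  open Graph G
  field
    length≥3 : 3 ≤ m
    vertex   : Fin m → Vertex
    distinct : Injective _≡_ _≡_ vertex
    adjacent : ∀ {i j} → CyclicSucc i j → Adj (vertex i) (vertex j)

{-# OPTIONS --safe #-}

-- Cut a piece of the ground set into d = 1 + 3t zones and look only at vertices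
-- that consist of a fixed set together with one point in every zone (size k+1),
-- or in every zone but one (size k).  The partite Ramsey theorem shrinks the
-- zones so that the colour of the edge deleting the j-th point depends on j
-- only; three zones X, Y, Z then share a colour.  In that colour we see the
-- incidence graph between transversals xyz and pairs xy, xz, yz.  With z fixed
-- this is a subdivided complete bipartite graph, so it has a 2l-cycle for each
-- even l ≥ 4; for odd l ≥ 7, walk round the three sides of one triple xyz,
-- using a detour with an odd number of triples for two of the sides.
module Submission where

open import Defs
open import Data.Fin as Fin using (Fin; zero; suc; toℕ; _↑ˡ_; _↑ʳ_; inject≤; funToFin; finToFun)
open import Data.Fin.Patterns using (0F; 1F; 2F)
open import Data.Fin.Properties as Fin using (toℕ<n; toℕ-injective; toℕ-fromℕ<; ↑ˡ-injective; ↑ʳ-injective; finToFun-funToFin)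
open import Data.Fin.Subset using (Subset; ⊥; ⊤; ⁅_⁆; ∣_∣; _∈_; _⊂_)
open import Data.Fin.Subset.Properties using (∉⊥; x∈⁅x⁆; x∈⁅y⁆⇒x≡y; s⊂s; out⊂in)
open import Data.List as List using (List; []; _∷_; length; filter)
open import Data.List.Properties using (length-map; length-tabulate)
open import Data.List.Relation.Unary.All as All using (All; []; _∷_)
open import Data.List.Relation.Unary.All.Properties as All using (all-filter)
open import Data.List.Relation.Unary.AllPairs using ([]; _∷_)
open import Data.List.Relation.Unary.Unique.Propositional using (Unique)
open import Data.List.Relation.Unary.Unique.Propositional.Properties using (filter⁺; allFin⁺)
open import Data.List.Membership.Propositional.Properties using (∈-lookup)
open import Data.Maybe as Maybe using (Maybe; just; nothing)
open import Data.Maybe.Properties using (just-injective)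
open import Data.Nat using (ℕ; zero; suc; _+_; _*_; _^_; _≤_; _<_; z≤n; s≤s; s≤s⁻¹; _≟_; _≤?_)
open import Data.Nat.DivMod using (_mod_; m%n<n; m≤n⇒m%n≡m)
open import Data.Nat.Properties using (≤-refl; ≤-trans; ≤-reflexive; n≤1+n; m≤n⇒m≤1+n; 1+n≰n; 1+n≢n; suc-injective; ≤∧≢⇒<; ≰⇒>; +-suc; +-comm; +-mono-≤; +-cancelˡ-<; <⇒≤; ≡-irrelevant; m≤n⇒∃[o]m+o≡n; module ≤-Reasoning)
open import Data.Nat.Tactic.RingSolver using (solve-∀)
open import Data.Product using (∃₂; ∃-syntax; _×_; _,_; proj₁; proj₂)
open import Data.Sum using (_⊎_; inj₁; inj₂)
open import Data.Vec as Vec using (Vec; []; _∷_; _++_; lookup; tabulate; _[_]≔_)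
open import Data.Vec.Properties using (lookup-map; lookup∘tabulate; tabulate∘lookup; tabulate-cong; map-[]≔; []≔-idempotent; []≔-commutes; lookup∘update; lookup∘update′; ++-injective; ++-injectiveʳ)
open import Function using (_∘_; id)
open import Function.Definitions using (Injective)
open import Relation.Binary.PropositionalEquality using (_≡_; _≢_; refl; sym; trans; cong; cong₂; subst; subst₂; module ≡-Reasoning)
open import Relation.Nullary using (¬_; yes; no; contradiction)
open import Relation.Nullary.Decidable using (¬?)
open import Relation.Unary using (Decidable)

-- Pigeonhole and partite Ramsey

lookup-injective : {A : Set} {xs : List A} → Unique xs → Injective _≡_ _≡_ (List.lookup xs)
lookup-injective (_  ∷ _) {zero}  {zero}  _  = refl
lookup-injective (x∉ ∷ _) {zero}  {suc j} eq = contradiction eq (All.lookup x∉ (∈-lookup j))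
lookup-injective (x∉ ∷ _) {suc i} {zero}  eq = contradiction (sym eq) (All.lookup x∉ (∈-lookup i))
lookup-injective (_  ∷ u) {suc i} {suc j} eq = cong suc (lookup-injective u eq)

length-filter-¬ : {A : Set} {P : A → Set} (P? : Decidable P) (xs : List A) →
  length (filter P? xs) + length (filter (¬? ∘ P?) xs) ≡ length xs
length-filter-¬ P? [] = refl
length-filter-¬ P? (x ∷ xs) with P? x
... | yes _ = cong suc (length-filter-¬ P? xs)
... | no  _ = trans (+-suc _ _) (cong suc (length-filter-¬ P? xs))

-- Induction on the number of values: if the largest one, `r`, is taken fewer than `m` times,
-- discarding its class leaves more than `r * m` entries with smaller values. The strict inequality
-- settles the base case, since it makes the list nonempty.
pigeonhole-list : {A : Set} (h : A → ℕ) (m r : ℕ) {xs : List A} →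
  Unique xs → All (λ x → h x < r) xs → r * m < length xs →
  ∃₂ λ c ys → Unique ys × All (λ y → h y ≡ c) ys × m ≤ length ys
pigeonhole-list h m zero    {_ ∷ _} _ (() ∷ _) _
pigeonhole-list h m (suc r) {xs} u h<r len with m ≤? length (filter (λ x → h x ≟ r) xs)
... | yes m≤ = r , _ , filter⁺ _ u , all-filter _ xs , m≤
... | no  m≰ = pigeonhole-list h m r (filter⁺ h≢r? u)
    (All.zipWith (λ (≢r , <r) → ≤∧≢⇒< (s≤s⁻¹ <r) ≢r) (all-filter h≢r? xs , All.filter⁺ h≢r? h<r))
    (+-cancelˡ-< m _ _ (begin-strict
      m + r * m                                                  <⟨ len ⟩
      length xs                                                  ≡⟨ length-filter-¬ h≡r? xs ⟨
      length (filter h≡r? xs) + length (filter h≢r? xs)          ≤⟨ +-mono-≤ (<⇒≤ (≰⇒> m≰)) ≤-refl ⟩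
      m + length (filter h≢r? xs)                                ∎))
  where
  open ≤-Reasoning
  h≡r? = λ x → h x ≟ r
  h≢r? = λ x → ¬? (h≡r? x)

pigeonhole : (r m : ℕ) (h : Fin (suc (r * m)) → Fin r) →
  ∃₂ λ c (e : Fin m → Fin (suc (r * m))) → Injective _≡_ _≡_ e × (∀ i → h (e i) ≡ c)
-- A colour must be named even when no points are asked for; the extra point in `suc (r * m)`
-- supplies one.
pigeonhole r zero h = h zero , (λ ()) , (λ {}) , λ ()
pigeonhole r m@(suc _) h
  with pigeonhole-list (toℕ ∘ h) m r (allFin⁺ (suc (r * m))) (All.tabulate λ {x} _ → toℕ<n (h x))
         (≤-reflexive (sym (length-tabulate id)))
... | c , ys , u , h≡c , m≤ = h (e zero) , e , e-inj , λ i → toℕ-injective (trans (colour i) (sym (colour zero)))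
  where
  e : Fin m → Fin (suc (r * m))
  e i = List.lookup ys (inject≤ i m≤)
  e-inj : Injective _≡_ _≡_ e
  e-inj eq = Fin.inject≤-injective m≤ m≤ _ _ (lookup-injective u eq)
  colour : ∀ i → toℕ (h (e i)) ≡ c
  colour i = All.lookup h≡c (∈-lookup (inject≤ i m≤))

InBox : ∀ {d m N} → (Fin d → Fin m → Fin N) → Vec (Fin N) d → Set
InBox e v = ∀ i → ∃[ x ] lookup v i ≡ e i x

InBox-[]≔ : ∀ {d m N} {e : Fin d → Fin m → Fin N} {v} → InBox e v → ∀ j x → InBox e (v [ j ]≔ e j x)
InBox-[]≔ {v = v} v∈ j x i with i Fin.≟ j
... | yes refl = x , lookup∘update i v _
... | no  i≢j  = proj₁ (v∈ i) , trans (lookup∘update′ i≢j v _) (proj₂ (v∈ i))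

vec-ext : {A : Set} {n : ℕ} {v w : Vec A n} → (∀ i → lookup v i ≡ lookup w i) → v ≡ w
vec-ext {v = v} {w} eq = trans (sym (tabulate∘lookup v)) (trans (tabulate-cong eq) (tabulate∘lookup w))

-- The first zone is treated last: a point of the other d zones is coloured by
-- the whole colouring of a line in the first direction.
boxRamsey : (d m r : ℕ) → ∃[ N ] ((f : Vec (Fin N) d → Fin r) →
  ∃₂ λ (e : Fin d → Fin m → Fin N) c →
    (∀ i → Injective _≡_ _≡_ (e i)) × (∀ v → InBox e v → f v ≡ c))
boxRamsey zero    m r = 0 , λ f → (λ ()) , f [] , (λ ()) , λ { [] _ → refl }
-- A line of `suc (r * m)` points suffices to find `m` of one colour, and it has `r ^ suc (r * m)`
-- colourings.
boxRamsey (suc d) m r with boxRamsey d m (r ^ suc (r * m))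
-- All zones have the same size, so the first uses only a left block of `N₁` points and the others
-- only a right block of `N₂` points.
... | N₂ , ramsey = N₁ + N₂ , step
  where
  N₁ = suc (r * m)
  step : (f : Vec (Fin (N₁ + N₂)) (suc d) → Fin r) →
    ∃₂ λ (e : Fin (suc d) → Fin m → Fin (N₁ + N₂)) c →
      (∀ i → Injective _≡_ _≡_ (e i)) × (∀ v → InBox e v → f v ≡ c)
  step f with ramsey (λ v → funToFin (λ x → f ((x ↑ˡ N₂) ∷ Vec.map (N₁ ↑ʳ_) v)))
  ... | e₂ , γ , e₂-inj , f≡γ with pigeonhole r m (finToFun γ)
  ... | c , e₁ , e₁-inj , γ≡c = e , c , e-inj , f≡c
    where
    e : Fin (suc d) → Fin m → Fin (N₁ + N₂)
    e zero    x = e₁ x ↑ˡ N₂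
    e (suc i) x = N₁ ↑ʳ e₂ i x
    e-inj : ∀ i → Injective _≡_ _≡_ (e i)
    e-inj zero    eq = e₁-inj (↑ˡ-injective N₂ _ _ eq)
    e-inj (suc i) eq = e₂-inj i (↑ʳ-injective N₁ _ _ eq)
    f≡c : ∀ v → InBox e v → f v ≡ c
    f≡c (y ∷ v) yv∈ = begin
      f (y ∷ v)                                       ≡⟨ cong₂ (λ y v → f (y ∷ v)) (proj₂ (yv∈ zero)) v≡ ⟩
      f ((x ↑ˡ N₂) ∷ Vec.map (N₁ ↑ʳ_) w)              ≡⟨ finToFun-funToFin line x ⟨
      finToFun (funToFin line) x                      ≡⟨ cong (λ g → finToFun g x) (f≡γ w w∈) ⟩
      finToFun γ x                                    ≡⟨ γ≡c _ ⟩
      c                                               ∎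
      where
      open ≡-Reasoning
      x = e₁ (proj₁ (yv∈ zero))
      -- The preimage of `v` in the right blocks, where the inductive hypothesis applies.
      w = tabulate (λ i → e₂ i (proj₁ (yv∈ (suc i))))
      line : Fin N₁ → Fin r
      line x = f ((x ↑ˡ N₂) ∷ Vec.map (N₁ ↑ʳ_) w)
      w∈ : InBox e₂ w
      w∈ i = _ , lookup∘tabulate _ i
      v≡ : v ≡ Vec.map (N₁ ↑ʳ_) w
      v≡ = vec-ext λ i → trans (proj₂ (yv∈ (suc i)))
        (sym (trans (lookup-map i (N₁ ↑ʳ_) w) (cong (N₁ ↑ʳ_) (lookup∘tabulate _ i))))

-- Cycles from closed walks

-- The index lists the visited vertices, both ends included. Distinctness is then `Unique xs`, and
-- `List.lookup xs` can serve as the vertex map of a cycle.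
data Walk {A : Set} (R : A → A → Set) : A → A → List A → Set where
  [-] : ∀ {u} → Walk R u u (u ∷ [])
  _∷_ : ∀ {u v w xs} → R u v → Walk R v w xs → Walk R u w (u ∷ xs)

infixr 5 _∷_

module _ {A : Set} {R : A → A → Set} where

  walk-map : {B : Set} {S : B → B → Set} {φ : A → B} → (∀ {u v} → R u v → S (φ u) (φ v)) →
    ∀ {u v xs} → Walk R u v xs → Walk S (φ u) (φ v) (List.map φ xs)
  walk-map hom [-]     = [-]
  walk-map hom (r ∷ w) = hom r ∷ walk-map hom w

  walk-first : ∀ {u v xs} → Walk R u v xs → ∀ j → toℕ j ≡ 0 → List.lookup xs j ≡ u
  walk-first [-]     zero _ = refl
  walk-first (_ ∷ _) zero _ = refl

  walk-last : ∀ {u v xs} → Walk R u v xs → ∀ i → suc (toℕ i) ≡ length xs → List.lookup xs i ≡ v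
  walk-last [-]           zero    _  = refl
  walk-last (_ ∷ [-])     zero    ()
  walk-last (_ ∷ (_ ∷ _)) zero    ()
  walk-last (_ ∷ w)       (suc i) eq = walk-last w i (suc-injective eq)

  walk-step : ∀ {u v xs} → Walk R u v xs → ∀ i j → toℕ j ≡ suc (toℕ i) →
    R (List.lookup xs i) (List.lookup xs j)
  walk-step [-]     zero    zero    ()
  walk-step (r ∷ w) zero    (suc j) eq = subst (R _) (sym (walk-first w j (suc-injective eq))) r
  walk-step (r ∷ w) (suc i) (suc j) eq = walk-step w i j (suc-injective eq)

closedWalk⇒Cycle : (G : Graph) {u v : Graph.Vertex G} {xs : List (Graph.Vertex G)} →
  Walk (Graph.Adj G) u v xs → Graph.Adj G v u → Unique xs → 3 ≤ length xs → Cycle G (length xs)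
closedWalk⇒Cycle G {u} {v} {xs} walk vu unique 3≤ = record
  { length≥3 = 3≤
  ; vertex   = List.lookup xs
  ; distinct = lookup-injective unique
  ; adjacent = adjacent
  }
  where
  open Graph G
  adjacent : ∀ {i j} → CyclicSucc i j → Adj (List.lookup xs i) (List.lookup xs j)
  adjacent {i} {j} (inj₁ j≡1+i)       = walk-step walk i j j≡1+i
  adjacent {i} {j} (inj₂ (end , j≡0)) =
    subst₂ Adj (sym (walk-last walk i end)) (sym (walk-first walk j j≡0)) vu

-- Injectivity is relative to `Q` because faces are sent to graph vertices injectively only while
-- their coordinates stay bounded.
unique-map-on : {A B : Set} {Q : A → Set} {φ : A → B} →
  (∀ {x y} → Q x → Q y → φ x ≡ φ y → x ≡ y) →
  ∀ {xs} → All Q xs → Unique xs → Unique (List.map φ xs)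
unique-map-on inj []       []       = []
unique-map-on inj (q ∷ qs) (x∉ ∷ u) =
  All.map⁺ (All.zipWith (λ (q′ , x≢y) eq → x≢y (inj q q′ eq)) (qs , x∉)) ∷ unique-map-on inj qs u

-- The incidence graph of the triples xyz and the pairs xy, xz, yz

data Face : Set where
  xyz      : (x y z : ℕ) → Face
  yz xz xy : (i j : ℕ) → Face

data _─_ : Face → Face → Set where
  -x : ∀ {x y z} → xyz x y z ─ yz y z
  -y : ∀ {x y z} → xyz x y z ─ xz x z
  -z : ∀ {x y z} → xyz x y z ─ xy x y
  +x : ∀ {x y z} → yz y z ─ xyz x y z
  +y : ∀ {x y z} → xz x z ─ xyz x y z
  +z : ∀ {x y z} → xy x y ─ xyz x y z

coordX coordY coordZ : Face → Maybe ℕ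
coordX (xyz x y z) = just x
coordX (yz y z)    = nothing
coordX (xz x z)    = just x
coordX (xy x y)    = just x
coordY (xyz x y z) = just y
coordY (yz y z)    = just y
coordY (xz x z)    = nothing
coordY (xy x y)    = just y
coordZ (xyz x y z) = just z
coordZ (yz y z)    = just z
coordZ (xz x z)    = just z
coordZ (xy x y)    = nothing

coords-injective : ∀ f g → coordX f ≡ coordX g → coordY f ≡ coordY g → coordZ f ≡ coordZ g → f ≡ g
coords-injective f g eqX eqY eqZ =
  trans (sym (face-coords f)) (trans (face-cong eqX eqY eqZ) (face-coords g))
  where
  face : Maybe ℕ → Maybe ℕ → Maybe ℕ → Face
  face (just x) (just y) (just z) = xyz x y z
  face nothing  (just y) (just z) = yz y z
  face (just x) nothing  (just z) = xz x z
  face (just x) (just y) nothing  = xy x y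
  -- A default for combinations with two or more missing coordinates, which no face has.
  face _        _        _        = xyz 0 0 0
  face-coords : ∀ f → face (coordX f) (coordY f) (coordZ f) ≡ f
  face-coords (xyz x y z) = refl
  face-coords (yz y z)    = refl
  face-coords (xz x z)    = refl
  face-coords (xy x y)    = refl
  face-cong : ∀ {a a′ b b′ c c′} → a ≡ a′ → b ≡ b′ → c ≡ c′ → face a b c ≡ face a′ b′ c′
  face-cong refl refl refl = refl

data Bounded (M : ℕ) : Face → Set where
  xyz : ∀ {x y z} → x ≤ M → y ≤ M → z ≤ M → Bounded M (xyz x y z)
  yz  : ∀ {y z} → y ≤ M → z ≤ M → Bounded M (yz y z)
  xz  : ∀ {x z} → x ≤ M → z ≤ M → Bounded M (xz x z)
  xy  : ∀ {x y} → x ≤ M → y ≤ M → Bounded M (xy x y)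

-- A staircase path in the layer z = 0, seen as a complete bipartite graph between the `yz j 0` and
-- the `xz i 0` whose edges are subdivided by triples. It avoids x = 0, which is kept free for
-- closing the cycle.
zigzag : ℕ → List Face
zigzag zero    = yz 0 0 ∷ []
zigzag (suc n) = yz (suc n) 0 ∷ xyz (suc n) (suc n) 0 ∷ xz (suc n) 0 ∷ xyz (suc n) n 0 ∷ zigzag n

zigzag-walk : ∀ n → Walk _─_ (yz n 0) (yz 0 0) (zigzag n)
zigzag-walk zero    = [-]
zigzag-walk (suc n) = +x ∷ -y ∷ +y ∷ -x ∷ zigzag-walk n

length-zigzag : ∀ n → length (zigzag n) ≡ 1 + 4 * n
length-zigzag zero    = refl
length-zigzag (suc n) = trans (cong (4 +_) (length-zigzag n)) (eq n)
  where
  eq : ∀ n → 4 + (1 + 4 * n) ≡ 1 + 4 * suc n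
  eq = solve-∀

-- A region containing the path, larger than the path but easy to leave: a face with x = 0 or z = 1
-- is excluded by its shape alone, and each new step of the staircase by its bounds.
data InZigzag (n : ℕ) : Face → Set where
  yz  : ∀ {j} → j ≤ n → InZigzag n (yz j 0)
  xz  : ∀ {i} → i < n → InZigzag n (xz (suc i) 0)
  xyz : ∀ {i j} → i < n → j ≤ n → InZigzag n (xyz (suc i) j 0)

inZigzag-suc : ∀ {n f} → InZigzag n f → InZigzag (suc n) f
inZigzag-suc (yz j≤n)      = yz (m≤n⇒m≤1+n j≤n)
inZigzag-suc (xz i<n)      = xz (m≤n⇒m≤1+n i<n)
inZigzag-suc (xyz i<n j≤n) = xyz (m≤n⇒m≤1+n i<n) (m≤n⇒m≤1+n j≤n)

zigzag-all : ∀ n → All (InZigzag n) (zigzag n)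
zigzag-all zero    = yz z≤n ∷ []
zigzag-all (suc n) = yz ≤-refl ∷ xyz ≤-refl ≤-refl ∷ xz ≤-refl ∷ xyz ≤-refl (n≤1+n n) ∷
  All.map inZigzag-suc (zigzag-all n)

zigzag-fresh : ∀ n {f} → ¬ InZigzag n f → All (f ≢_) (zigzag n)
zigzag-fresh n f∉ = All.map (λ { g∈ refl → f∉ g∈ }) (zigzag-all n)

zigzag-unique : ∀ n → Unique (zigzag n)
zigzag-unique zero    = [] ∷ []
zigzag-unique (suc n) =
  ((λ ()) ∷ (λ ()) ∷ (λ ()) ∷ zigzag-fresh n λ { (yz p) → 1+n≰n p }) ∷
  ((λ ()) ∷ (λ ()) ∷ zigzag-fresh n λ { (xyz p _) → 1+n≰n p }) ∷
  ((λ ()) ∷ zigzag-fresh n λ { (xz p) → 1+n≰n p }) ∷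
  (zigzag-fresh n λ { (xyz p _) → 1+n≰n p }) ∷
  zigzag-unique n

zigzag-bounded : ∀ {M n} → n ≤ M → All (Bounded M) (zigzag n)
zigzag-bounded {M} {n} n≤M = All.map bound (zigzag-all n)
  where
  bound : ∀ {f} → InZigzag n f → Bounded M f
  bound (yz j≤n)      = yz (≤-trans j≤n n≤M) z≤n
  bound (xz i<n)      = xz (≤-trans i<n n≤M) z≤n
  bound (xyz i<n j≤n) = xyz (≤-trans i<n n≤M) (≤-trans j≤n n≤M) z≤n

-- This depends on neither the colouring nor `k`, so `bound` is available when the side of the
-- Ramsey box is chosen.
record FaceCycle (m : ℕ) : Set where
  field
    bound       : ℕ
    start end   : Face
    faces       : List Face
    walk        : Walk _─_ start end faces
    closing     : end ─ start
    unique      : Unique faces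
    bounded     : All (Bounded bound) faces
    length≡     : length faces ≡ m

-- The path from `yz a 0` down to `yz 0 0` is closed through `xz 0 0`. Three extra faces make the
-- length 4(a + 1), which fixes `a`.
evenFaceCycle : ∀ n → FaceCycle (2 * (6 + 2 * n))
evenFaceCycle n = record
  { bound   = a
  ; faces   = xyz 0 0 0 ∷ xz 0 0 ∷ xyz 0 a 0 ∷ zigzag a
  ; walk    = -y ∷ +y ∷ -x ∷ zigzag-walk a
  ; closing = +x
  ; unique  = ((λ ()) ∷ (λ ()) ∷ zigzag-fresh a λ ()) ∷ ((λ ()) ∷ zigzag-fresh a λ ()) ∷
      (zigzag-fresh a λ ()) ∷ zigzag-unique a
  ; bounded = xyz z≤n z≤n z≤n ∷ xz z≤n z≤n ∷ xyz z≤n ≤-refl z≤n ∷ zigzag-bounded ≤-refl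
  ; length≡ = trans (cong (3 +_) (length-zigzag a)) (eq n)
  }
  where
  a = 2 + n
  eq : ∀ n → 3 + (1 + 4 * (2 + n)) ≡ 2 * (6 + 2 * n)
  eq = solve-∀

-- The edge from `xyz 0 0 0` to `xz 0 0` of the even cycle is replaced by a detour through z = 1. It
-- adds three triples and three pairs, so the number of triples changes parity. The fresh value y =
-- 1 + a keeps the detour away from `xyz 0 a 0`.
oddFaceCycle : ∀ n → FaceCycle (2 * (7 + 2 * n))
oddFaceCycle n = record
  { bound   = 1 + a
  ; faces   = xyz 0 0 0 ∷ xy 0 0 ∷ xyz 0 0 1 ∷ xz 0 1 ∷ xyz 0 (1 + a) 1 ∷ xy 0 (1 + a) ∷
      xyz 0 (1 + a) 0 ∷ xz 0 0 ∷ xyz 0 a 0 ∷ zigzag a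
  ; walk    = -z ∷ +z ∷ -y ∷ +y ∷ -z ∷ +z ∷ -y ∷ +y ∷ -x ∷ zigzag-walk a
  ; closing = +x
  ; unique  =
      ((λ ()) ∷ (λ ()) ∷ (λ ()) ∷ (λ ()) ∷ (λ ()) ∷ (λ ()) ∷ (λ ()) ∷ (λ ()) ∷ zigzag-fresh a λ ()) ∷
      ((λ ()) ∷ (λ ()) ∷ (λ ()) ∷ (λ ()) ∷ (λ ()) ∷ (λ ()) ∷ (λ ()) ∷ zigzag-fresh a λ ()) ∷
      ((λ ()) ∷ (λ ()) ∷ (λ ()) ∷ (λ ()) ∷ (λ ()) ∷ (λ ()) ∷ zigzag-fresh a λ ()) ∷
      ((λ ()) ∷ (λ ()) ∷ (λ ()) ∷ (λ ()) ∷ (λ ()) ∷ zigzag-fresh a λ ()) ∷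
      ((λ ()) ∷ (λ ()) ∷ (λ ()) ∷ (λ ()) ∷ zigzag-fresh a λ ()) ∷
      ((λ ()) ∷ (λ ()) ∷ (λ ()) ∷ zigzag-fresh a λ ()) ∷
      ((λ ()) ∷ (λ ()) ∷ zigzag-fresh a λ ()) ∷
      ((λ ()) ∷ zigzag-fresh a λ ()) ∷
      (zigzag-fresh a λ ()) ∷
      zigzag-unique a
  ; bounded = xyz z≤n z≤n z≤n ∷ xy z≤n z≤n ∷ xyz z≤n z≤n (s≤s z≤n) ∷ xz z≤n (s≤s z≤n) ∷
      xyz z≤n ≤-refl (s≤s z≤n) ∷ xy z≤n ≤-refl ∷ xyz z≤n ≤-refl z≤n ∷ xz z≤n z≤n ∷
      xyz z≤n (n≤1+n a) z≤n ∷ zigzag-bounded (n≤1+n a)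
  ; length≡ = trans (cong (9 +_) (length-zigzag a)) (eq n)
  }
  where
  -- Positive, since for a = 0 the triple `xyz 0 a 0` would repeat `xyz 0 0 0`.
  a = 1 + n
  eq : ∀ n → 9 + (1 + 4 * (1 + n)) ≡ 2 * (7 + 2 * n)
  eq = solve-∀

even⊎odd : ∀ n → ∃[ q ] (n ≡ 2 * q ⊎ n ≡ 1 + 2 * q)
even⊎odd zero = 0 , inj₁ refl
even⊎odd (suc n) with even⊎odd n
... | q , inj₁ refl = q , inj₂ refl
... | q , inj₂ refl = suc q , inj₁ (eq q)
  where
  eq : ∀ q → 2 + 2 * q ≡ 2 * suc q
  eq = solve-∀

faceCycle : ∀ l → 6 ≤ l → FaceCycle (2 * l)
faceCycle l 6≤l with m≤n⇒∃[o]m+o≡n 6≤l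
... | c , refl with even⊎odd c
... | q , inj₁ refl = evenFaceCycle q
... | q , inj₂ refl = oddFaceCycle q

-- Partial transversals as subsets

⟦_⟧ : ∀ {d N} → Vec (Maybe (Fin N)) d → Subset (d * N)
⟦ [] ⟧          = []
⟦ just x ∷ w ⟧  = ⁅ x ⁆ ++ ⟦ w ⟧
⟦ nothing ∷ w ⟧ = ⊥ ++ ⟦ w ⟧

∣⊥++p∣≡∣p∣ : ∀ m {n} (p : Subset n) → ∣ ⊥ {m} ++ p ∣ ≡ ∣ p ∣
∣⊥++p∣≡∣p∣ zero    p = refl
∣⊥++p∣≡∣p∣ (suc m) p = ∣⊥++p∣≡∣p∣ m p

∣⊤++p∣≡m+∣p∣ : ∀ m {n} (p : Subset n) → ∣ ⊤ {m} ++ p ∣ ≡ m + ∣ p ∣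
∣⊤++p∣≡m+∣p∣ zero    p = refl
∣⊤++p∣≡m+∣p∣ (suc m) p = cong suc (∣⊤++p∣≡m+∣p∣ m p)

∣⁅x⁆++p∣≡1+∣p∣ : ∀ {m n} (x : Fin m) (p : Subset n) → ∣ ⁅ x ⁆ ++ p ∣ ≡ suc ∣ p ∣
∣⁅x⁆++p∣≡1+∣p∣ {suc m} zero    p = cong suc (∣⊥++p∣≡∣p∣ m p)
∣⁅x⁆++p∣≡1+∣p∣         (suc x) p = ∣⁅x⁆++p∣≡1+∣p∣ x p

⊥++p⊂⁅x⁆++p : ∀ {m n} (x : Fin m) (p : Subset n) → ⊥ ++ p ⊂ ⁅ x ⁆ ++ p
⊥++p⊂⁅x⁆++p zero    p = out⊂in id
⊥++p⊂⁅x⁆++p (suc x) p = s⊂s (⊥++p⊂⁅x⁆++p x p)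

++⁺ˡ-⊂ : ∀ {m n} (r : Subset m) {p q : Subset n} → p ⊂ q → r ++ p ⊂ r ++ q
++⁺ˡ-⊂ []      p⊂q = p⊂q
++⁺ˡ-⊂ (s ∷ r) p⊂q = s⊂s (++⁺ˡ-⊂ r p⊂q)

⁅⁆-injective : ∀ {n} → Injective _≡_ _≡_ (⁅_⁆ {n})
⁅⁆-injective {n} {x} {y} eq = x∈⁅y⁆⇒x≡y y (subst (x ∈_) eq (x∈⁅x⁆ x))

⁅x⁆≢⊥ : ∀ {n} {x : Fin n} → ⁅ x ⁆ ≢ ⊥
⁅x⁆≢⊥ {x = x} eq = ∉⊥ (subst (x ∈_) eq (x∈⁅x⁆ x))

⟦⟧-injective : ∀ {d N} → Injective _≡_ _≡_ (⟦_⟧ {d} {N})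
⟦⟧-injective {x = []} {[]} _ = refl
⟦⟧-injective {x = just x ∷ w} {just y ∷ w′} eq with ++-injective ⁅ x ⁆ ⁅ y ⁆ eq
... | eq₁ , eq₂ = cong₂ _∷_ (cong just (⁅⁆-injective eq₁)) (⟦⟧-injective eq₂)
⟦⟧-injective {x = just x ∷ w} {nothing ∷ w′} eq = contradiction (proj₁ (++-injective ⁅ x ⁆ ⊥ eq)) ⁅x⁆≢⊥
⟦⟧-injective {x = nothing ∷ w} {just y ∷ w′} eq = contradiction (sym (proj₁ (++-injective ⊥ ⁅ y ⁆ eq))) ⁅x⁆≢⊥
⟦⟧-injective {x = nothing ∷ w} {nothing ∷ w′} eq = cong (nothing ∷_) (⟦⟧-injective (proj₂ (++-injective ⊥ ⊥ eq)))

∣⟦just⟧∣≡d : ∀ {d N} (v : Vec (Fin N) d) → ∣ ⟦ Vec.map just v ⟧ ∣ ≡ d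
∣⟦just⟧∣≡d []      = refl
∣⟦just⟧∣≡d (x ∷ v) = trans (∣⁅x⁆++p∣≡1+∣p∣ x _) (cong suc (∣⟦just⟧∣≡d v))

∣⟦delete⟧∣≡d : ∀ {d N} (v : Vec (Fin N) (suc d)) j → ∣ ⟦ Vec.map just v [ j ]≔ nothing ⟧ ∣ ≡ d
∣⟦delete⟧∣≡d {N = N} (x ∷ v)       zero    = trans (∣⊥++p∣≡∣p∣ N _) (∣⟦just⟧∣≡d v)
∣⟦delete⟧∣≡d         (x ∷ v@(_ ∷ _)) (suc j) = trans (∣⁅x⁆++p∣≡1+∣p∣ x _) (cong suc (∣⟦delete⟧∣≡d v j))

⟦delete⟧⊂⟦just⟧ : ∀ {d N} (v : Vec (Fin N) d) j → ⟦ Vec.map just v [ j ]≔ nothing ⟧ ⊂ ⟦ Vec.map just v ⟧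
⟦delete⟧⊂⟦just⟧ (x ∷ v) zero    = ⊥++p⊂⁅x⁆++p x _
⟦delete⟧⊂⟦just⟧ (x ∷ v) (suc j) = ++⁺ˡ-⊂ ⁅ x ⁆ (⟦delete⟧⊂⟦just⟧ v j)

vertex-≡ : ∀ {n k} {u v : JohnsonVertex n k} → proj₁ u ≡ proj₁ v → u ≡ v
vertex-≡ {k = k} {p , s} {.p , s′} refl = cong (p ,_) (irrelevant s s′)
  where
  k≢k+1 : k ≢ k + 1
  k≢k+1 eq = 1+n≢n (sym (trans eq (+-comm k 1)))
  irrelevant : (s s′ : (∣ p ∣ ≡ k) ⊎ (∣ p ∣ ≡ k + 1)) → s ≡ s′
  irrelevant (inj₁ a) (inj₁ b) = cong inj₁ (≡-irrelevant a b)
  irrelevant (inj₁ a) (inj₂ b) = contradiction (trans (sym a) b) k≢k+1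
  irrelevant (inj₂ a) (inj₁ b) = contradiction (trans (sym b) a) k≢k+1
  irrelevant (inj₂ a) (inj₂ b) = cong inj₂ (≡-irrelevant a b)

mod-injective-≤ : ∀ {M i j} → i ≤ M → j ≤ M → i mod suc M ≡ j mod suc M → i ≡ j
mod-injective-≤ {M} {i} {j} i≤M j≤M eq = begin
  i                     ≡⟨ toℕ-mod i≤M ⟨
  toℕ (i mod suc M)     ≡⟨ cong toℕ eq ⟩
  toℕ (j mod suc M)     ≡⟨ toℕ-mod j≤M ⟩
  j                     ∎
  where
  open ≡-Reasoning
  toℕ-mod : ∀ {i} → i ≤ M → toℕ (i mod suc M) ≡ i
  toℕ-mod {i} i≤M = trans (toℕ-fromℕ< (m%n<n i (suc M))) (m≤n⇒m%n≡m i≤M)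

-- `Q` is demanded only of coordinates that are present, as a deleted coordinate carries no bound.
Maybe-map-injective-on : {A B : Set} {Q : A → Set} {f : A → B} →
  (∀ {x y} → Q x → Q y → f x ≡ f y → x ≡ y) →
  ∀ {a b} → (∀ {x} → a ≡ just x → Q x) → (∀ {x} → b ≡ just x → Q x) →
  Maybe.map f a ≡ Maybe.map f b → a ≡ b
Maybe-map-injective-on inj {just x}  {just y}  qa qb eq = cong just (inj (qa refl) (qb refl) (just-injective eq))
Maybe-map-injective-on inj {nothing} {nothing} qa qb eq = refl

boundedX : ∀ {M f} → Bounded M f → ∀ {i} → coordX f ≡ just i → i ≤ M
boundedX (xyz p _ _) refl = p
boundedX (xz p _)    refl = p
boundedX (xy p _)    refl = p

boundedY : ∀ {M f} → Bounded M f → ∀ {i} → coordY f ≡ just i → i ≤ M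
boundedY (xyz _ p _) refl = p
boundedY (yz p _)    refl = p
boundedY (xy _ p)    refl = p

boundedZ : ∀ {M f} → Bounded M f → ∀ {i} → coordZ f ≡ just i → i ≤ M
boundedZ (xyz _ _ p) refl = p
boundedZ (yz _ p)    refl = p
boundedZ (xz _ p)    refl = p

-- Transversals varying in three zones

module Embedding
  {d N M : ℕ} (e : Fin (suc d) → Fin (suc M) → Fin N) (e-inj : ∀ i → Injective _≡_ _≡_ (e i))
  (p : Fin 3 → Fin (suc d)) (p-inj : Injective _≡_ _≡_ p)
  where

  -- Reduction modulo `suc M` makes this total on natural coordinates; it is faithful up to `M`.
  E : Fin (suc d) → ℕ → Fin N
  E i n = e i (n mod suc M)

  E-injective : ∀ i {m n} → m ≤ M → n ≤ M → E i m ≡ E i n → m ≡ n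
  E-injective i m≤M n≤M eq = mod-injective-≤ m≤M n≤M (e-inj i eq)

  p-distinct : ∀ {i j} → i ≢ j → p i ≢ p j
  p-distinct i≢j eq = i≢j (p-inj eq)

  base : Vec (Fin N) (suc d)
  base = tabulate λ i → E i 0

  base∈ : InBox e base
  base∈ i = 0 mod suc M , lookup∘tabulate (λ i → E i 0) i

  point : ℕ → ℕ → ℕ → Vec (Fin N) (suc d)
  point x y z = base [ p 2F ]≔ E (p 2F) z [ p 1F ]≔ E (p 1F) y [ p 0F ]≔ E (p 0F) x

  point∈ : ∀ x y z → InBox e (point x y z)
  point∈ x y z = InBox-[]≔ {v = v₁} (InBox-[]≔ {v = v₂} (InBox-[]≔ {v = base} base∈
    (p 2F) (z mod suc M)) (p 1F) (y mod suc M)) (p 0F) (x mod suc M)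
    where
    v₂ = base [ p 2F ]≔ E (p 2F) z
    v₁ = v₂ [ p 1F ]≔ E (p 1F) y

  wordZ : Maybe ℕ → Vec (Maybe (Fin N)) (suc d)
  wordZ c = Vec.map just base [ p 2F ]≔ Maybe.map (E (p 2F)) c

  wordYZ : Maybe ℕ → Maybe ℕ → Vec (Maybe (Fin N)) (suc d)
  wordYZ b c = wordZ c [ p 1F ]≔ Maybe.map (E (p 1F)) b

  word : Maybe ℕ → Maybe ℕ → Maybe ℕ → Vec (Maybe (Fin N)) (suc d)
  word a b c = wordYZ b c [ p 0F ]≔ Maybe.map (E (p 0F)) a

  map-just-point : ∀ x y z → Vec.map just (point x y z) ≡ word (just x) (just y) (just z)
  map-just-point x y z = trans (map-[]≔ just _ (p 0F)) (cong (_[ p 0F ]≔ _)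
    (trans (map-[]≔ just _ (p 1F)) (cong (_[ p 1F ]≔ _) (map-[]≔ just base (p 2F)))))

  deleteX : ∀ a b c → word a b c [ p 0F ]≔ nothing ≡ word nothing b c
  deleteX a b c = []≔-idempotent (wordYZ b c) (p 0F)

  -- The update to be overwritten lies beneath the one at `p 0F`; the zones are distinct, so the
  -- deletion commutes past it.
  deleteY : ∀ a b c → word a b c [ p 1F ]≔ nothing ≡ word a nothing c
  deleteY a b c = trans ([]≔-commutes (wordYZ b c) (p 0F) (p 1F) (p-distinct λ ()))
    (cong (_[ p 0F ]≔ _) ([]≔-idempotent (wordZ c) (p 1F)))

  deleteZ : ∀ a b c → word a b c [ p 2F ]≔ nothing ≡ word a b nothing
  deleteZ a b c = trans ([]≔-commutes (wordYZ b c) (p 0F) (p 2F) (p-distinct λ ())) (cong (_[ p 0F ]≔ _)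
    (trans ([]≔-commutes (wordZ c) (p 1F) (p 2F) (p-distinct λ ()))
      (cong (_[ p 1F ]≔ _) ([]≔-idempotent (Vec.map just base) (p 2F)))))

  lookupX : ∀ a b c → lookup (word a b c) (p 0F) ≡ Maybe.map (E (p 0F)) a
  lookupX a b c = lookup∘update (p 0F) (wordYZ b c) _

  lookupY : ∀ a b c → lookup (word a b c) (p 1F) ≡ Maybe.map (E (p 1F)) b
  lookupY a b c = trans (lookup∘update′ (p-distinct {1F} {0F} λ ()) (wordYZ b c) _)
    (lookup∘update (p 1F) (wordZ c) _)

  lookupZ : ∀ a b c → lookup (word a b c) (p 2F) ≡ Maybe.map (E (p 2F)) c
  lookupZ a b c = trans (lookup∘update′ (p-distinct {2F} {0F} λ ()) (wordYZ b c) _)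
    (trans (lookup∘update′ (p-distinct {2F} {1F} λ ()) (wordZ c) _)
      (lookup∘update (p 2F) (Vec.map just base) _))

  faceWord : Face → Vec (Maybe (Fin N)) (suc d)
  faceWord f = word (coordX f) (coordY f) (coordZ f)

  -- Reading the word in the three chosen zones recovers the coordinates of the face.
  faceWord-injective : ∀ {f g} → Bounded M f → Bounded M g → faceWord f ≡ faceWord g → f ≡ g
  faceWord-injective {f} {g} f≤ g≤ eq = coords-injective f g
    (Maybe-map-injective-on (E-injective (p 0F)) (boundedX f≤) (boundedX g≤) (same (p 0F) lookupX))
    (Maybe-map-injective-on (E-injective (p 1F)) (boundedY f≤) (boundedY g≤) (same (p 1F) lookupY))
    (Maybe-map-injective-on (E-injective (p 2F)) (boundedZ f≤) (boundedZ g≤) (same (p 2F) lookupZ))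
    where
    same : ∀ i {h : Maybe ℕ → Maybe ℕ → Maybe ℕ → Maybe (Fin N)} →
      (∀ a b c → lookup (word a b c) i ≡ h a b c) →
      h (coordX f) (coordY f) (coordZ f) ≡ h (coordX g) (coordY g) (coordZ g)
    same i look = trans (sym (look _ _ _)) (trans (cong (λ w → lookup w i) eq) (look _ _ _))

-- Words as vertices of the doubled Johnson graph

module _ {t d N : ℕ} (a b : ℕ) where

  private
    n = a + (b + suc d * N)
    k = a + d

  -- The first `a` elements lie in every vertex and adjust the size to `k`; the next `b` lie in none
  -- and pad the ground set.
  embed : Vec (Maybe (Fin N)) (suc d) → Subset n
  embed w = ⊤ {a} ++ (⊥ {b} ++ ⟦ w ⟧)

  embed-injective : Injective _≡_ _≡_ embed
  embed-injective eq = ⟦⟧-injective (++-injectiveʳ (⊥ {b}) ⊥ (++-injectiveʳ (⊤ {a}) ⊤ eq))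

  ∣embed∣ : ∀ w {s} → ∣ ⟦ w ⟧ ∣ ≡ s → ∣ embed w ∣ ≡ a + s
  ∣embed∣ w eq = trans (∣⊤++p∣≡m+∣p∣ a _) (cong (a +_) (trans (∣⊥++p∣≡∣p∣ b _) eq))

  upper : Vec (Fin N) (suc d) → JohnsonVertex n k
  upper v = embed (Vec.map just v) ,
    inj₂ (trans (∣embed∣ (Vec.map just v) (∣⟦just⟧∣≡d v)) (trans (+-suc a d) (+-comm 1 k)))

  lower : Vec (Fin N) (suc d) → Fin (suc d) → JohnsonVertex n k
  lower v j = embed (Vec.map just v [ j ]≔ nothing) , inj₁ (∣embed∣ (Vec.map just v [ j ]≔ nothing) (∣⟦delete⟧∣≡d v j))

  upper-lower : ∀ v j → Graph.Adj (doubledJohnson n k) (upper v) (lower v j)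
  upper-lower v j = inj₂ (++⁺ˡ-⊂ (⊤ {a}) (++⁺ˡ-⊂ (⊥ {b}) (⟦delete⟧⊂⟦just⟧ v j)))

  module _ (P : EdgePartition (doubledJohnson n k) t) where

    open EdgePartition P

    colour : Vec (Fin N) (suc d) → Fin (suc d) → Fin t
    colour v j = proj₁ (covers {upper v} {lower v j} (upper-lower v j))

    module _ {M : ℕ} (e : Fin (suc d) → Fin (suc M) → Fin N) (e-inj : ∀ i → Injective _≡_ _≡_ (e i))
             (p : Fin 3 → Fin (suc d)) (p-inj : Injective _≡_ _≡_ p) (c : Fin t)
             (mono : ∀ v → InBox e v → ∀ i → colour v (p i) ≡ c)
      where

      open Embedding e e-inj p p-inj

      vertexOf : Face → JohnsonVertex n k
      vertexOf (xyz x y z) = upper (point x y z)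
      -- The 0 is a placeholder: the coordinate in the deleted zone leaves no trace.
      vertexOf (yz y z)    = lower (point 0 y z) (p 0F)
      vertexOf (xz x z)    = lower (point x 0 z) (p 1F)
      vertexOf (xy x y)    = lower (point x y 0) (p 2F)

      upper-word : ∀ x y z → proj₁ (upper (point x y z)) ≡ embed (word (just x) (just y) (just z))
      upper-word x y z = cong embed (map-just-point x y z)

      lower-word : ∀ x y z j → proj₁ (lower (point x y z) j) ≡ embed (word (just x) (just y) (just z) [ j ]≔ nothing)
      lower-word x y z j = cong (λ w → embed (w [ j ]≔ nothing)) (map-just-point x y z)

      -- The right side is independent of `x`, so all the triples over one pair share this lower
      -- neighbour.
      lowerX : ∀ x y z → proj₁ (lower (point x y z) (p 0F)) ≡ embed (faceWord (yz y z))
      lowerX x y z = trans (lower-word x y z (p 0F)) (cong embed (deleteX (just x) (just y) (just z)))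

      lowerY : ∀ x y z → proj₁ (lower (point x y z) (p 1F)) ≡ embed (faceWord (xz x z))
      lowerY x y z = trans (lower-word x y z (p 1F)) (cong embed (deleteY (just x) (just y) (just z)))

      lowerZ : ∀ x y z → proj₁ (lower (point x y z) (p 2F)) ≡ embed (faceWord (xy x y))
      lowerZ x y z = trans (lower-word x y z (p 2F)) (cong embed (deleteZ (just x) (just y) (just z)))

      vertexOf-word : ∀ f → proj₁ (vertexOf f) ≡ embed (faceWord f)
      vertexOf-word (xyz x y z) = upper-word x y z
      vertexOf-word (yz y z)    = lowerX 0 y z
      vertexOf-word (xz x z)    = lowerY x 0 z
      vertexOf-word (xy x y)    = lowerZ x y 0

      vertexOf-injective : ∀ {f g} → Bounded M f → Bounded M g → vertexOf f ≡ vertexOf g → f ≡ g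
      vertexOf-injective {f} {g} f≤ g≤ eq = faceWord-injective f≤ g≤ (embed-injective
        (trans (sym (vertexOf-word f)) (trans (cong proj₁ eq) (vertexOf-word g))))

      -- The edge deleting zone `p i` has colour `c` by `mono`; comparing words identifies its lower
      -- end with `vertexOf f`.
      deletion-edge : ∀ x y z i f → proj₁ (lower (point x y z) (p i)) ≡ embed (faceWord f) →
        Part c (upper (point x y z)) (vertexOf f)
      deletion-edge x y z i f eq = subst₂ (λ c v → Part c (upper (point x y z)) v)
        (mono (point x y z) (point∈ x y z) i) (vertex-≡ (trans eq (sym (vertexOf-word f))))
        (proj₂ (covers {v} {lower (point x y z) (p i)} (upper-lower (point x y z) (p i))))
        where v = upper (point x y z)

      vertexOf-hom : ∀ {f g} → f ─ g → Part c (vertexOf f) (vertexOf g)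
      vertexOf-hom (-x {x} {y} {z}) = deletion-edge x y z 0F (yz y z) (lowerX x y z)
      vertexOf-hom (-y {x} {y} {z}) = deletion-edge x y z 1F (xz x z) (lowerY x y z)
      vertexOf-hom (-z {x} {y} {z}) = deletion-edge x y z 2F (xy x y) (lowerZ x y z)
      vertexOf-hom (+x {x} {y} {z}) = part-symm (vertexOf-hom (-x {x} {y} {z}))
      vertexOf-hom (+y {x} {y} {z}) = part-symm (vertexOf-hom (-y {x} {y} {z}))
      vertexOf-hom (+z {x} {y} {z}) = part-symm (vertexOf-hom (-z {x} {y} {z}))

-- Choosing the parameters

doubledJohnson-cycle : (t : ℕ) {m : ℕ} → 3 ≤ m → FaceCycle m →
  ∃[ N ] (∀ a b (P : EdgePartition (doubledJohnson (a + (b + suc (t * 3) * N)) (a + t * 3)) t) →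
    ∃[ i ] Cycle (partGraph P i) m)
doubledJohnson-cycle t 3≤m C
  -- A point is coloured by the whole pattern of colours of its `suc (t * 3)` deletions; the side
  -- leaves room for coordinates 0 to `bound`.
  with boxRamsey (suc (t * 3)) (suc (FaceCycle.bound C)) (t ^ suc (t * 3))
... | N , ramsey = N , cycle
  where
  open FaceCycle C
  d = t * 3
  cycle : ∀ a b (P : EdgePartition (doubledJohnson (a + (b + suc d * N)) (a + d)) t) →
    ∃[ i ] Cycle (partGraph P i) _
  cycle a b P with ramsey (λ v → funToFin (colour a b P v))
  -- Within the box the pattern is constant, and among 1 + 3t zones three have the same colour.
  ... | e , γ , e-inj , mono with pigeonhole t 3 (finToFun γ)
  ... | c , p , p-inj , γ≡c = c , subst (Cycle (partGraph P c)) len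
      (closedWalk⇒Cycle (partGraph P c) (walk-map (λ {u} {v} → hom {u} {v}) walk) (hom closing)
        (unique-map-on (vertexOf-injective a b P e e-inj p p-inj c mono′) bounded unique)
        (subst (3 ≤_) (sym len) 3≤m))
    where
    mono′ : ∀ v → InBox e v → ∀ i → colour a b P v (p i) ≡ c
    mono′ v v∈ i = trans (sym (finToFun-funToFin (colour a b P v) (p i)))
      (trans (cong (λ g → finToFun g (p i)) (mono v v∈)) (γ≡c i))
    φ = vertexOf a b P e e-inj p p-inj c mono′
    hom : ∀ {f g} → f ─ g → EdgePartition.Part P c (φ f) (φ g)
    hom = vertexOf-hom a b P e e-inj p p-inj c mono′
    len : length (List.map φ faces) ≡ _
    len = trans (length-map φ faces) length≡

doubledOdd-from-doubledJohnson : {t m : ℕ} (d s k : ℕ) → s + d ≤ k →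
  (∀ a b (P : EdgePartition (doubledJohnson (a + (b + s)) (a + d)) t) → ∃[ i ] Cycle (partGraph P i) m) →
  (P : EdgePartition (doubledOdd k) t) → ∃[ i ] Cycle (partGraph P i) m
doubledOdd-from-doubledJohnson {t} {m} d s k s+d≤k cycle with m≤n⇒∃[o]m+o≡n s+d≤k
... | c , refl = subst₂ (λ n k → (P : EdgePartition (doubledJohnson n k) t) → ∃[ i ] Cycle (partGraph P i) m)
    -- With k = s + d + c, the size condition a + d = k forces a = s + c, and a + b + s = 2k + 1
    -- then forces b = 2d + c + 1.
    (n≡ s d c) (k≡ s d c) (cycle (s + c) (2 * d + c + 1))
  where
  n≡ : ∀ s d c → s + c + (2 * d + c + 1 + s) ≡ 2 * (s + d + c) + 1
  n≡ = solve-∀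
  k≡ : ∀ s d c → s + c + d ≡ s + d + c
  k≡ = solve-∀

theorem1p3 : (t l : ℕ) → 1 ≤ t → 6 ≤ l →
    ∃[ k₀ ] ((k : ℕ) → 1 ≤ k → k₀ ≤ k →
    (P : EdgePartition (doubledOdd k) t) →
    ∃[ i ] Cycle (partGraph P i) (2 * l))
theorem1p3 t l _ 6≤l =
  let N , cycle = doubledJohnson-cycle t 3≤2l (faceCycle l 6≤l) in
  -- The threshold is the total size of the zones plus the number of zone points in a lower vertex.
  suc (t * 3) * N + t * 3 , λ k _ k₀≤k → doubledOdd-from-doubledJohnson (t * 3) (suc (t * 3) * N) k k₀≤k cycle
  where
  3≤2l : 3 ≤ 2 * l
  3≤2l = ≤-trans (s≤s (s≤s (s≤s z≤n))) (+-mono-≤ 6≤l z≤n)
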